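{- Let $n\ge2$ and $1\le k\le n-1$. Let $W=S_n$ with simple reflections $S=\{s_1,\dots,s_{n-1}\}$, $s_i=(i\ \,i+1)$, let $J=S\setminus\{s_k\}$, let $w\in W^J$ be a Grassmannian permutation, let $m=\ell(w)$, and let $\lambda=\lambda(w)$ be its associated shape. To each valid firing sequence $(i_1,\dots,i_m)$ of the Modified Kostant Game on the Dynkin diagram $A_{n-1}$ with active set $I=\{k\}$ that produces $w$ (i.e. $s_{i_m}\cdots s_{i_1}=w$), assign a filling as follows: start from the empty shape, and for $j=1,\dots,m$ successively place the integer $j$ in the unique addable cell $(r,c)$ of the shape formed by the cells filled so far that satisfies $c-r=i_j-k$. Then this step-by-step procedure is well defined and constitutes a bijection from the set of valid firing sequences producing $w$ onto the set $\mathrm{SYT}(\lambda)$ of Standard Young Tableaux of shape $\lambda$.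
   Context: $W^J=\{w\in S_n:\ell(ws_j)>\ell(w)\text{ for all }j\ne k\}$ is the set of minimal length representatives of the left cosets $S_n/(S_k\times S_{n-k})$; its elements, called Grassmannian permutations, are the $w$ with $w(1)<\cdots<w(k)$ and $w(k+1)<\cdots<w(n)$. The shape associated with $w\in W^J$ is the partition $\lambda(w)=(w(k)-k,\;w(k-1)-(k-1),\;\dots,\;w(1)-1)$ (zero parts dropped), whose Young diagram fits in a $k\times(n-k)$ rectangle and has $\ell(w)$ cells. Cells are denoted $(r,c)$ with row $r$ counted from top to bottom and column $c$ from left to right (English notation). An addable cell of a Young diagram is a cell not in the diagram whose addition gives again a Young diagram. A Standard Young Tableau of shape $\lambda$ with $m$ cells is a bijective filling by $1,\dots,m$ that strictly increases along rows and down columns. Modified Kostant Game on $A_{n-1}$ with active set $\{k\}$: the vertices are $1,\dots,n-1$, with $i$ and $i'$ adjacent iff $|i-i'|=1$. A configuration is $c=(c_1,\dots,c_{n-1})\in\mathbb Z_{\ge0}^{n-1}$; set $c_0=c_n=0$. With $\epsilon_v=1$ if $v=k$ and $\epsilon_v=0$ otherwise, vertex $v$ is sad if $c_v<\tfrac12(c_{v-1}+c_{v+1}+\epsilon_v)$; firing a sad vertex $v$ replaces $c_v$ by $c_{v-1}+c_{v+1}+\epsilon_v-c_v$ and leaves the other entries unchanged. The game starts from the zero configuration. A sequence $(i_1,\dots,i_m)$ is a valid firing sequence if each $i_j$ is sad at the moment it is fired when $i_1,\dots,i_m$ are fired successively starting from $\mathbf 0$. -}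

-- The rank is r = n - 1, so W = S_n acts on Fin (suc r), and an element k : Fin r
-- exists only when n ≥ 2.  Everything is counted from zero: i : Fin r stands for
-- the vertex (or simple reflection) i + 1, the cell (x , y) for (x + 1 , y + 1),
-- and a tableau entry j : Fin m for j + 1.
module Defs where

open import Data.Bool.Base using (if_then_else_)
open import Data.Fin.Base as Fin using (Fin; Fin′; suc; toℕ; inject; inject₁; opposite)
open import Data.Fin.Permutation as Perm using (Permutation′; _⟨$⟩ʳ_; _∘ₚ_)
open import Data.Fin.Properties using (_≟_)
open import Data.Integer.Base using (_⊖_)
open import Data.List.Base as List using (List; []; _∷_)
open import Data.List.Relation.Unary.All using (All)
open import Data.List.Relation.Unary.Linked using (Linked)
open import Data.Nat.Base using (ℕ; zero; suc; _+_; _*_; _∸_; _≤_; _<_; _≥_; _>_)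
open import Data.Nat.Properties using (_<?_)
open import Data.Product.Base using (Σ-syntax; ∃; ∃-syntax; _×_; _,_)
open import Data.Unit.Base using (⊤)
open import Data.Vec.Base as Vec using (Vec; []; _∷_; _∷ʳ_; _[_]≔_)
open import Function.Definitions using (Bijective)
open import Level using (0ℓ)
open import Relation.Binary.Bundles using (Setoid)
import Relation.Binary.Construct.On as On
open import Relation.Binary.PropositionalEquality.Core using (_≡_; _≢_)
open import Relation.Binary.PropositionalEquality using (setoid; _→-setoid_)
open import Relation.Nullary.Decidable.Core using (does)
open import Relation.Unary using (Pred; _∈_; _∉_; _∪_; ∅; ｛_｝; _≐_)

infixl 7 _·_

-- Group multiplication with the usual convention (u · v)(x) = u (v x).
_·_ : ∀ {n} → Permutation′ n → Permutation′ n → Permutation′ n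
u · v = v ∘ₚ u

s : ∀ {r} → Fin r → Permutation′ (suc r)
s i = Perm.transpose (inject₁ i) (suc i)

-- (i₁ , … , iₗ) ↦ s_{iₗ} ⋯ s_{i₁}
product : ∀ {r l} → Vec (Fin r) l → Permutation′ (suc r)
product []       = Perm.id
product (i ∷ is) = product is · s i

-- m = ℓ(w), the Coxeter length.
record IsLength {r} (w : Permutation′ (suc r)) (m : ℕ) : Set where
  field
    attained : ∃[ is ] product {r} {m} is Perm.≈ w
    minimal  : ∀ {l} (is : Vec (Fin r) l) → product is Perm.≈ w → m ≤ l

-- w ∈ W^J for J = S ∖ {s_k}.
Grassmannian : ∀ {r} → Fin r → Permutation′ (suc r) → Set
Grassmannian k w =
  ∀ j → j ≢ k → ∀ {a b} → IsLength w a → IsLength (w · s j) b → b > a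

-- The truncated subtraction is exact when w ∈ W^J, since then w(i) ≥ i for i ≤ k.
-- Fin′ (suc k) consists of the positions up to and including k.
shape : ∀ {r} → Fin r → Permutation′ (suc r) → List ℕ
shape k w = List.filter (0 <?_) (List.tabulate part)
  where
  part : Fin′ (suc k) → ℕ
  part t = let i = inject {i = suc k} (opposite t) in toℕ (w ⟨$⟩ʳ i) ∸ toℕ i

Cell : Set
Cell = ℕ × ℕ

record IsPartition (μ : List ℕ) : Set where
  field
    decreasing : Linked _≥_ μ
    positive   : All (0 <_) μ

rowLength : List ℕ → ℕ → ℕ
rowLength []      _       = 0
rowLength (a ∷ _) zero    = a
rowLength (_ ∷ μ) (suc x) = rowLength μ x

Diagram : List ℕ → Pred Cell 0ℓ
Diagram μ (x , y) = y < rowLength μ x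

IsYoungDiagram : Pred Cell 0ℓ → Set
IsYoungDiagram D = ∃[ μ ] IsPartition μ × D ≐ Diagram μ

Addable : Pred Cell 0ℓ → Pred Cell 0ℓ
Addable D p = p ∉ D × IsYoungDiagram (D ∪ ｛ p ｝)

record SYT (μ : List ℕ) (m : ℕ) : Set where
  field
    entry         : ∃ (Diagram μ) → Fin m
    bijective     : Bijective _≡_ _≡_ entry
    rowsIncrease  : ∀ {x y y′} (p : (x , y) ∈ Diagram μ) (q : (x , y′) ∈ Diagram μ) →
                    y < y′ → entry ((x , y) , p) Fin.< entry ((x , y′) , q)
    colsIncrease  : ∀ {x x′ y} (p : (x , y) ∈ Diagram μ) (q : (x′ , y) ∈ Diagram μ) →
                    x < x′ → entry ((x , y) , p) Fin.< entry ((x′ , y) , q)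

SYT-setoid : List ℕ → ℕ → Setoid 0ℓ 0ℓ
SYT-setoid μ m = On.setoid (∃ (Diagram μ) →-setoid Fin m) (SYT.entry {μ} {m})

Config : ℕ → Set
Config r = Vec ℕ r

-- c_{v-1} + c_{v+1} + ε_v, where c_0 = c_n = 0.
neighbourSum : ∀ {r} → Fin r → Config r → Fin r → ℕ
neighbourSum k c v =
  Vec.lookup (0 ∷ c) (inject₁ v) + Vec.lookup (c ∷ʳ 0) (suc v)
    + (if does (v ≟ k) then 1 else 0)

-- c_v < ½ (c_{v-1} + c_{v+1} + ε_v) with the denominator cleared.
Sad : ∀ {r} → Fin r → Config r → Fin r → Set
Sad k c v = 2 * Vec.lookup c v < neighbourSum k c v

-- The truncated subtraction is exact at a sad vertex.
fire : ∀ {r} → Fin r → Config r → Fin r → Config r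
fire k c v = c [ v ]≔ (neighbourSum k c v ∸ Vec.lookup c v)

ValidFrom : ∀ {r l} → Fin r → Config r → Vec (Fin r) l → Set
ValidFrom k c []       = ⊤
ValidFrom k c (i ∷ is) = Sad k c i × ValidFrom k (fire k c i) is

record FiringSequence {r} (k : Fin r) (w : Permutation′ (suc r)) (m : ℕ) : Set where
  field
    seq      : Vec (Fin r) m
    valid    : ValidFrom k (Vec.replicate r 0) seq
    produces : product seq Perm.≈ w

FiringSequence-setoid : ∀ {r} → Fin r → Permutation′ (suc r) → ℕ → Setoid 0ℓ 0ℓ
FiringSequence-setoid {r} k w m =
  On.setoid (setoid (Vec (Fin r) m)) (FiringSequence.seq {k = k} {w})

-- Counting from zero changes neither c - r nor i - k; _⊖_ is the difference in ℤ.
AddableAt : ∀ {r} → Fin r → Pred Cell 0ℓ → Fin r → Pred Cell 0ℓ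
AddableAt k D i p@(x , y) = Addable D p × y ⊖ x ≡ toℕ i ⊖ toℕ k

-- Starting from the filled cells D, the procedure applied to the given vertices
-- never gets stuck or faces a choice, and fills the given cells in this order.
Places : ∀ {r l} → Fin r → Pred Cell 0ℓ → Vec (Fin r) l → Vec Cell l → Set
Places k D []       []       = ⊤
Places k D (i ∷ is) (p ∷ ps) =
  (AddableAt k D i p × (∀ q → AddableAt k D i q → q ≡ p)) × Places k (D ∪ ｛ p ｝) is ps

-- The procedure applied to the vertices is well defined and its outcome is T.
Assigns : ∀ {r μ m} → Fin r → Vec (Fin r) m → SYT μ m → Set
Assigns {μ = μ} {m} k is T =
  Σ[ ps ∈ Vec Cell m ] Places k ∅ is ps ×
    (∀ j → Σ[ p∈μ ∈ Vec.lookup ps j ∈ Diagram μ ] SYT.entry T (Vec.lookup ps j , p∈μ) ≡ j)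

{-# OPTIONS --safe #-}
-- A Grassmannian permutation u has the Young diagram whose rows end at u(p) - p, for
-- the first k positions p.  If u is the product of the vertices fired so far, then
-- c_v counts the cells of this diagram on the diagonal v - k, and the amount by which
-- the neighbours of v exceed 2 c_v is [v ∈ A] - [v + 1 ∈ A], where A is the set of
-- values of u at the first k positions.  So v is sad exactly when v ∈ A and v + 1 ∉ A,
-- that is, when a cell with content v - k is addable, and firing v turns u into s_v u
-- and adds this cell.  Valid firing sequences are therefore the content sequences of
-- the standard orders in which a diagram can be filled, and since u is determined by
-- its diagram, those producing w are the ones that fill the shape of w.
module Submission where

open import Defs
open import Data.Bool.Base using (if_then_else_)
open import Data.Fin.Base as Fin using (Fin; zero; suc; toℕ; inject; inject₁; fromℕ<; opposite)
open import Data.Fin.Induction using (<-weakInduction)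
open import Data.Fin.Permutation as Perm using (Permutation′; _⟨$⟩ʳ_; _⟨$⟩ˡ_; transpose)
open import Data.Fin.Properties as Fin
  using (_≟_; <-cmp; toℕ-injective; toℕ-inject₁; toℕ-inject; toℕ-fromℕ<; toℕ<n; opposite-prop)
open import Data.Integer.Base as ℤ using (_⊖_)
open import Data.Integer.Properties as ℤ using (+-cancelˡ-⊖; distribˡ-⊖-+-pos)
open import Data.List.Base as List using (List; []; _∷_)
open import Data.List.Relation.Unary.All using (All; []; _∷_)
open import Data.List.Relation.Unary.All.Properties using (all-filter)
open import Data.List.Relation.Unary.AllPairs using (AllPairs; []; _∷_)
import Data.List.Relation.Unary.AllPairs.Properties as AllPairs
open import Data.List.Relation.Unary.Linked.Properties using (AllPairs⇒Linked; Linked⇒AllPairs)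
open import Data.Nat.Base using (ℕ; zero; suc; _+_; _*_; _∸_; _≤_; _<_; _≥_; z≤n; s≤s; s≤s⁻¹)
open import Data.Nat.Properties hiding (_≟_; <-cmp)
open import Data.Nat.Tactic.RingSolver using (solve-∀)
open import Data.Product.Base using (Σ-syntax; ∃; _×_; _,_; proj₁; proj₂)
open import Data.Sum.Base as Sum using (_⊎_; inj₁; inj₂)
open import Data.Unit.Base using (⊤; tt)
open import Data.Vec.Base as Vec using (Vec; []; _∷_; _∷ʳ_; _[_]≔_)
open import Data.Vec.Properties using (lookup-replicate; lookup∘tabulate)
open import Function.Base using (_∘_)
open import Function.Bundles using (Bijection)
open import Level using (0ℓ)
open import Relation.Binary.Definitions using (tri<; tri≈; tri>)
open import Relation.Binary.PropositionalEquality
  using (_≡_; _≢_; refl; sym; trans; cong; cong₂; subst; subst₂; module ≡-Reasoning)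
open import Relation.Nullary.Decidable using (yes; no; does; dec-true; dec-false; _×-dec_)
open import Relation.Nullary.Negation using (¬_; contradiction)
open import Relation.Unary using (Pred; _∈_; _∉_; _∪_; ∅; ｛_｝; _≐_; _⊆_)
open import Relation.Unary.Properties using (≐-sym; ≐-trans)

-- Transpositions and simple reflections

module _ {n} (a b : Fin n) where

  transpose-ˡ : transpose a b ⟨$⟩ʳ a ≡ b
  transpose-ˡ rewrite dec-true (a ≟ a) refl = refl

  transpose-ʳ : transpose a b ⟨$⟩ʳ b ≡ a
  transpose-ʳ with b ≟ a
  ... | yes b≡a = b≡a
  ... | no  _   rewrite dec-true (b ≟ b) refl = refl

  transpose-≢ : ∀ {x} → x ≢ a → x ≢ b → transpose a b ⟨$⟩ʳ x ≡ x
  transpose-≢ {x} x≢a x≢b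
    rewrite dec-false (x ≟ a) x≢a | dec-false (x ≟ b) x≢b = refl

⟨$⟩ʳ-injective : ∀ {n} (u : Permutation′ n) {x y} → u ⟨$⟩ʳ x ≡ u ⟨$⟩ʳ y → x ≡ y
⟨$⟩ʳ-injective u eq = trans (sym (Perm.inverseˡ u)) (trans (cong (u ⟨$⟩ˡ_) eq) (Perm.inverseˡ u))

-- The rule for conjugating a transposition, in a form without inverses; it lets `exchange` move the
-- swap of two positions past a letter of the word.
transpose-conj : ∀ {n} (u : Permutation′ n) a b x →
  transpose (u ⟨$⟩ʳ a) (u ⟨$⟩ʳ b) ⟨$⟩ʳ (u ⟨$⟩ʳ x) ≡ u ⟨$⟩ʳ (transpose a b ⟨$⟩ʳ x)
transpose-conj u a b x with x ≟ a
... | yes refl = transpose-ˡ (u ⟨$⟩ʳ a) (u ⟨$⟩ʳ b)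
... | no x≢a with x ≟ b
...   | yes refl = transpose-ʳ (u ⟨$⟩ʳ a) (u ⟨$⟩ʳ b)
...   | no x≢b =
        transpose-≢ (u ⟨$⟩ʳ a) (u ⟨$⟩ʳ b) (x≢a ∘ ⟨$⟩ʳ-injective u) (x≢b ∘ ⟨$⟩ʳ-injective u)

inject₁<suc : ∀ {r} (i : Fin r) → toℕ (inject₁ i) < toℕ (Fin.suc i)
inject₁<suc i = s≤s (≤-reflexive (toℕ-inject₁ i))

inject₁≢suc : ∀ {r} (i : Fin r) → inject₁ i ≢ suc i
inject₁≢suc i eq = <⇒≢ (inject₁<suc i) (cong toℕ eq)

-- The graph of `s i`, given as a relation so that a match yields an argument together with its
-- image.
data Swap {r} (i : Fin r) : Fin (suc r) → Fin (suc r) → Set where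
  up    : Swap i (inject₁ i) (suc i)
  down  : Swap i (suc i) (inject₁ i)
  fixed : ∀ {x} → x ≢ inject₁ i → x ≢ suc i → Swap i x x

s-swap : ∀ {r} (i : Fin r) x → Swap i x (s i ⟨$⟩ʳ x)
s-swap i x with x ≟ inject₁ i
... | yes refl = up
... | no x≢i with x ≟ suc i
...   | yes refl = down
...   | no x≢1+i = fixed x≢i x≢1+i

Swap-sym : ∀ {r} {i : Fin r} {x y} → Swap i x y → Swap i y x
Swap-sym up            = down
Swap-sym down          = up
Swap-sym (fixed ≢i ≢1+i) = fixed ≢i ≢1+i

Swap-functional : ∀ {r} {i : Fin r} {x y z} → Swap i x y → Swap i x z → y ≡ z
Swap-functional = aux refl
  where
  -- The shared argument is split into `x` and `x′` with an equation between them, since matching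
  -- directly would have to unify `inject₁ i` with `suc i`.
  aux : ∀ {r} {i : Fin r} {x x′ y z} → x ≡ x′ → Swap i x y → Swap i x′ z → y ≡ z
  aux eq up              up            = refl
  aux eq up              down          = contradiction eq (inject₁≢suc _)
  aux eq up              (fixed ≢i _)  = contradiction (sym eq) ≢i
  aux eq down            up            = contradiction (sym eq) (inject₁≢suc _)
  aux eq down            down          = refl
  aux eq down            (fixed _ ≢1+i) = contradiction (sym eq) ≢1+i
  aux eq (fixed ≢i _)    up            = contradiction eq ≢i
  aux eq (fixed _ ≢1+i)  down          = contradiction eq ≢1+i
  aux eq (fixed _ _)     (fixed _ _)   = eq

s-involutive : ∀ {r} (i : Fin r) x → s i ⟨$⟩ʳ (s i ⟨$⟩ʳ x) ≡ x
s-involutive i x = Swap-functional (s-swap i (s i ⟨$⟩ʳ x)) (Swap-sym (s-swap i x))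

-- No value lies strictly between i and i + 1, so this is the only pair whose order gets reversed.
Swap-mono-< : ∀ {r} {i : Fin r} {a b a′ b′} → Swap i a a′ → Swap i b b′ → a Fin.< b →
  ¬ (a ≡ inject₁ i × b ≡ suc i) → a′ Fin.< b′
Swap-mono-< up up a<b _ = contradiction a<b (<-irrefl refl)
Swap-mono-< up down _ ¬ab = contradiction (refl , refl) ¬ab
Swap-mono-< {i = i} up (fixed {b} ≢i ≢1+i) a<b _ =
  ≤∧≢⇒< (subst (_< toℕ b) (toℕ-inject₁ i) a<b) (≢1+i ∘ sym ∘ toℕ-injective)
Swap-mono-< down up a<b _ = contradiction a<b (<-asym (inject₁<suc _))
Swap-mono-< down down a<b _ = contradiction a<b (<-irrefl refl)
Swap-mono-< down (fixed _ _) a<b _ = <-trans (inject₁<suc _) a<b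
Swap-mono-< (fixed _ _) up a<b _ = <-trans a<b (inject₁<suc _)
Swap-mono-< {i = i} (fixed ≢i _) down a<b _ =
  ≤∧≢⇒< (≤-trans (s≤s⁻¹ a<b) (≤-reflexive (sym (toℕ-inject₁ i)))) (≢i ∘ toℕ-injective)
Swap-mono-< (fixed _ _) (fixed _ _) a<b _ = a<b

s-mono-< : ∀ {r} (i : Fin r) {a b} → a Fin.< b → ¬ (a ≡ inject₁ i × b ≡ suc i) →
  (s i ⟨$⟩ʳ a) Fin.< (s i ⟨$⟩ʳ b)
s-mono-< i = Swap-mono-< (s-swap i _) (s-swap i _)

-- The exchange property and the increasing blocks of a Grassmannian permutation

-- Follow the values at a and b through the word: at the letter where their order
-- flips they are i and i + 1, and deleting that letter amounts to swapping a and b.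
exchange : ∀ {r l} (is : Vec (Fin r) l) {a b} → a Fin.< b →
  (product is ⟨$⟩ʳ b) Fin.< (product is ⟨$⟩ʳ a) →
  Σ[ l′ ∈ ℕ ] l ≡ suc l′ × Σ[ is′ ∈ Vec (Fin r) l′ ] product is′ Perm.≈ product is · transpose a b
exchange [] a<b b<a = contradiction b<a (<-asym a<b)
exchange (i ∷ is) {a} {b} a<b inv with (a ≟ inject₁ i) ×-dec (b ≟ suc i)
... | yes (refl , refl) =
      _ , refl , is , λ x → cong (product is ⟨$⟩ʳ_) (sym (s-involutive i x))
... | no ¬ab with exchange is (s-mono-< i a<b ¬ab) inv
...   | l′ , refl , is′ , eq = suc l′ , refl , i ∷ is′ , λ x →
        trans (eq (s i ⟨$⟩ʳ x)) (cong (product is ⟨$⟩ʳ_) (transpose-conj (s i) a b x))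

module _ {r} {k : Fin r} {w : Permutation′ (suc r)} (grass : Grassmannian k w)
         {m} (len : IsLength w m) where

  open IsLength len

  -- At a descent, `exchange` would delete a letter from a reduced word of `w`, making `w · s j`
  -- shorter than `w`, against `grass`.
  grassmannian-ascent : ∀ {j} → j ≢ k → (w ⟨$⟩ʳ inject₁ j) Fin.< (w ⟨$⟩ʳ suc j)
  grassmannian-ascent {j} j≢k with <-cmp (w ⟨$⟩ʳ inject₁ j) (w ⟨$⟩ʳ suc j)
  ... | tri< lt _ _ = lt
  ... | tri≈ _ eq _ = contradiction (⟨$⟩ʳ-injective w eq) (inject₁≢suc j)
  ... | tri> _ _ gt with attained
  ...   | is , is≈w with exchange is (inject₁<suc j)
              (subst₂ Fin._<_ (sym (is≈w (suc j))) (sym (is≈w (inject₁ j))) gt)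
  ...     | l′ , refl , is′ , is′≈ =
            contradiction (grass j j≢k len shorter) (<-asym (n<1+n l′))
    where
    shorter : IsLength (w · s j) l′
    shorter .IsLength.attained = is′ , λ x → trans (is′≈ x) (is≈w (s j ⟨$⟩ʳ x))
    -- A word for `w · s j`, extended by the letter `j`, is a word for `w`, so it is at most one
    -- letter shorter than a reduced word of `w`.
    shorter .IsLength.minimal is″ is″≈ = s≤s⁻¹ (minimal (j ∷ is″) λ x →
      trans (is″≈ (s j ⟨$⟩ʳ x)) (cong (w ⟨$⟩ʳ_) (s-involutive j x)))

-- W^J described by one-line notation. Since no lengths are involved, the property is easily carried
-- along a firing sequence.
record Sorted {r} (k : Fin r) (u : Permutation′ (suc r)) : Set where
  field
    below : ∀ {p q} → p Fin.< q → toℕ q ≤ toℕ k → (u ⟨$⟩ʳ p) Fin.< (u ⟨$⟩ʳ q)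
    above : ∀ {p q} → p Fin.< q → toℕ k < toℕ p → (u ⟨$⟩ʳ p) Fin.< (u ⟨$⟩ʳ q)

ascents⇒< : ∀ {r n} (g : Fin (suc r) → Fin n) {p q} → p Fin.< q →
  (∀ j → toℕ p ≤ toℕ j → toℕ j < toℕ q → g (inject₁ j) Fin.< g (suc j)) → g p Fin.< g q
ascents⇒< g {p} {q} = <-weakInduction P (λ p<0 → contradiction p<0 n≮0) step q
  where
  P : Fin _ → Set
  P q = p Fin.< q → (∀ j → toℕ p ≤ toℕ j → toℕ j < toℕ q → g (inject₁ j) Fin.< g (suc j)) →
    g p Fin.< g q
  step : ∀ i → P (inject₁ i) → P (suc i)
  step i ih p<1+i asc with m≤n⇒m<n∨m≡n (s≤s⁻¹ p<1+i)
  ... | inj₁ p<i = <-trans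
        (ih (<-≤-trans p<i (≤-reflexive (sym (toℕ-inject₁ i)))) λ j p≤j j<i →
          asc j p≤j (<-trans j<i (inject₁<suc i)))
        (asc i (<⇒≤ p<i) ≤-refl)
  ... | inj₂ p≡i = subst (λ z → g z Fin.< g (suc i))
        (toℕ-injective (trans (toℕ-inject₁ i) (sym p≡i))) (asc i (≤-reflexive p≡i) ≤-refl)

grassmannian⇒sorted : ∀ {r} {k : Fin r} {w m} → Grassmannian k w → IsLength w m → Sorted k w
grassmannian⇒sorted {w = w} grass len = record
  { below = λ p<q q≤k → ascents⇒< (w ⟨$⟩ʳ_) p<q λ j _ j<q →
      grassmannian-ascent grass len (<⇒≢ (<-≤-trans j<q q≤k) ∘ cong toℕ)
  ; above = λ p<q k<p → ascents⇒< (w ⟨$⟩ʳ_) p<q λ j p≤j _ →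
      grassmannian-ascent grass len (<⇒≢ (<-≤-trans k<p p≤j) ∘ cong toℕ ∘ sym)
  }

-- Row lengths and Young diagrams

rowLength-tabulate : ∀ {n} (g : Fin n → ℕ) t → rowLength (List.tabulate g) (toℕ t) ≡ g t
rowLength-tabulate g zero    = refl
rowLength-tabulate g (suc t) = rowLength-tabulate (g ∘ suc) t

rowLength-tabulate-≥ : ∀ {n} (g : Fin n → ℕ) {x} → n ≤ x → rowLength (List.tabulate g) x ≡ 0
rowLength-tabulate-≥ {zero}  g n≤x       = refl
rowLength-tabulate-≥ {suc n} g (s≤s n≤x) = rowLength-tabulate-≥ (g ∘ suc) n≤x

rowLength-≤ : ∀ {a μ} → All (a ≥_) μ → ∀ x → rowLength μ x ≤ a
rowLength-≤ []          x       = z≤n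
rowLength-≤ (a≥b ∷ _)   zero    = a≥b
rowLength-≤ (_ ∷ a≥μ)   (suc x) = rowLength-≤ a≥μ x

rowLength-antitone : ∀ {μ} → AllPairs _≥_ μ → ∀ {x x′} → x ≤ x′ → rowLength μ x′ ≤ rowLength μ x
rowLength-antitone []          _           = z≤n
rowLength-antitone (_ ∷ _)     {x′ = zero} z≤n = ≤-refl
rowLength-antitone (a≥μ ∷ _)   {x′ = suc x′} z≤n = rowLength-≤ a≥μ x′
rowLength-antitone (_ ∷ dec)   (s≤s x≤x′)  = rowLength-antitone dec x≤x′

-- In a weakly decreasing list all zeros stand at the end, where `rowLength` is 0 anyway.
rowLength-filter : ∀ {μ} → AllPairs _≥_ μ → ∀ x →
  rowLength (List.filter (0 <?_) μ) x ≡ rowLength μ x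
rowLength-filter []          x = refl
rowLength-filter (_∷_ {zero} 0≥μ dec) zero    = trans (rowLength-filter dec 0) (n≤0⇒n≡0 (rowLength-≤ 0≥μ 0))
rowLength-filter (_∷_ {zero} 0≥μ dec) (suc x) =
  trans (rowLength-filter dec (suc x)) (trans (n≤0⇒n≡0 (rowLength-≤ 0≥μ (suc x))) (sym (n≤0⇒n≡0 (rowLength-≤ 0≥μ x))))
rowLength-filter (_∷_ {suc a} _ dec) zero    = refl
rowLength-filter (_∷_ {suc a} _ dec) (suc x) = rowLength-filter dec x

youngDiagram-lower : ∀ {D} → IsYoungDiagram D → ∀ {x x′ y y′} → x′ ≤ x → y′ ≤ y →
  (x , y) ∈ D → (x′ , y′) ∈ D
youngDiagram-lower (μ , part , D⊆μ , μ⊆D) x′≤x y′≤y p∈D =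
  μ⊆D (≤-<-trans y′≤y (<-≤-trans (D⊆μ p∈D)
    (rowLength-antitone (Linked⇒AllPairs (λ a≥b b≥c → ≤-trans b≥c a≥b) decreasing) x′≤x)))
  where open IsPartition part

-- The Young diagram of a sorted permutation, and its growth under firing

-- The Young diagram of u, with the row x of the position p = k - x reaching up to
-- the column u(p) - p.
Filled : ∀ {r} → Fin r → Permutation′ (suc r) → Pred Cell 0ℓ
Filled k u (x , y) = Σ[ p ∈ Fin _ ] x + toℕ p ≡ toℕ k × y + toℕ p < toℕ (u ⟨$⟩ʳ p)

-- The condition that A contains i but not i + 1, expressed by the positions of these two values.
Fireable : ∀ {r} → Fin r → Permutation′ (suc r) → Fin r → Set
Fireable k u i = toℕ (u ⟨$⟩ˡ inject₁ i) ≤ toℕ k × toℕ k < toℕ (u ⟨$⟩ˡ suc i)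

-- The first free cell in the row of the position p that holds the value i: its column u(p) - p is i
-- - p. Both subtractions are exact when `u` is sorted and `i` is fireable.
cell : ∀ {r} → Fin r → Permutation′ (suc r) → Fin r → Cell
cell k u i = toℕ k ∸ toℕ (u ⟨$⟩ˡ inject₁ i) , toℕ i ∸ toℕ (u ⟨$⟩ˡ inject₁ i)

Filled-resp-≈ : ∀ {r} (k : Fin r) u v → u Perm.≈ v → Filled k u ⊆ Filled k v
Filled-resp-≈ k u v u≈v {_ , y} (p , row , col) = p , row , subst (λ q → y + toℕ p < toℕ q) (u≈v p) col

Filled-id : ∀ {r} (k : Fin r) → Filled k Perm.id ≐ ∅
Filled-id k = (λ (p , _ , y+p<p) → contradiction (≤-trans y+p<p (m≤n+m _ _)) (<-irrefl refl)) , λ ()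

Sorted-id : ∀ {r} (k : Fin r) → Sorted k Perm.id
Sorted-id k = record { below = λ p<q _ → p<q ; above = λ p<q _ → p<q }

⟨$⟩ʳ≡⇒⟨$⟩ˡ≡ : ∀ {n} (u : Permutation′ n) {p q} → u ⟨$⟩ʳ p ≡ q → p ≡ u ⟨$⟩ˡ q
⟨$⟩ʳ≡⇒⟨$⟩ˡ≡ u refl = sym (Perm.inverseˡ u)

module _ {r} {k : Fin r} {u : Permutation′ (suc r)} (sorted : Sorted k u) where

  open Sorted sorted

  -- Successive values on the first block differ by at least one. So u(p) - p is weakly increasing
  -- there, which makes the parts of the shape decreasing.
  sorted-grows : ∀ d {p q} → toℕ q ≡ d + toℕ p → toℕ q ≤ toℕ k →
    d + toℕ (u ⟨$⟩ʳ p) ≤ toℕ (u ⟨$⟩ʳ q)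
  sorted-grows zero    q≡p q≤k = ≤-reflexive (cong (toℕ ∘ (u ⟨$⟩ʳ_)) (sym (toℕ-injective q≡p)))
  sorted-grows (suc d) {p} {suc q} 1+q≡1+d+p 1+q≤k = ≤-<-trans
    (sorted-grows d (trans (toℕ-inject₁ q) (suc-injective 1+q≡1+d+p))
      (≤-trans (<⇒≤ (inject₁<suc q)) 1+q≤k))
    (below (inject₁<suc q) 1+q≤k)

  sorted-≥ : ∀ {p} → toℕ p ≤ toℕ k → toℕ p ≤ toℕ (u ⟨$⟩ʳ p)
  sorted-≥ {p} p≤k = ≤-trans (m≤m+n _ _) (sorted-grows (toℕ p) {zero} {p} (sym (+-identityʳ _)) p≤k)

  private
    -- `position` and `part` repeat the terms inside `shape`, so that `shape k u` is by computation
    -- the filtered list of these parts.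
    position : Fin (suc (toℕ k)) → Fin (suc r)
    position t = inject {i = suc k} (opposite t)

    part : Fin (suc (toℕ k)) → ℕ
    part t = toℕ (u ⟨$⟩ʳ position t) ∸ toℕ (position t)

    toℕ-position : ∀ t → toℕ (position t) ≡ toℕ k ∸ toℕ t
    toℕ-position t = trans (toℕ-inject (opposite t)) (opposite-prop t)

    position+t : ∀ t → toℕ t + toℕ (position t) ≡ toℕ k
    position+t t = trans (cong (toℕ t +_) (toℕ-position t)) (m+[n∸m]≡n (s≤s⁻¹ (toℕ<n t)))

    position≤k : ∀ t → toℕ (position t) ≤ toℕ k
    position≤k t = ≤-trans (m≤n+m _ _) (≤-reflexive (position+t t))

    part-antitone : ∀ {t t′} → t Fin.< t′ → part t ≥ part t′
    part-antitone {t} {t′} t<t′ = begin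
      toℕ (u ⟨$⟩ʳ p′) ∸ toℕ p′              ≡⟨ [m+n]∸[m+o]≡n∸o d _ (toℕ p′) ⟨
      (d + toℕ (u ⟨$⟩ʳ p′)) ∸ (d + toℕ p′)  ≤⟨ ∸-monoˡ-≤ (d + toℕ p′) (sorted-grows d p≡d+p′ (position≤k t)) ⟩
      toℕ (u ⟨$⟩ʳ p) ∸ (d + toℕ p′)         ≡⟨ cong (toℕ (u ⟨$⟩ʳ p) ∸_) p≡d+p′ ⟨
      toℕ (u ⟨$⟩ʳ p) ∸ toℕ p                ∎
      where
      open ≤-Reasoning
      p p′ : Fin (suc r)
      p = position t
      p′ = position t′
      d : ℕ
      d = toℕ p ∸ toℕ p′
      p≡d+p′ : toℕ p ≡ d + toℕ p′
      p≡d+p′ = sym (m∸n+n≡m (subst₂ _≤_ (sym (toℕ-position t′)) (sym (toℕ-position t)) (∸-monoʳ-≤ (toℕ k) (<⇒≤ t<t′))))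

    parts-decreasing : AllPairs _≥_ (List.tabulate part)
    parts-decreasing = AllPairs.tabulate⁺-< part-antitone

    rowLength-shape : ∀ t → rowLength (shape k u) (toℕ t) ≡ part t
    rowLength-shape t = trans (rowLength-filter parts-decreasing (toℕ t)) (rowLength-tabulate part t)

    rowLength-shape-> : ∀ {x} → toℕ k < x → rowLength (shape k u) x ≡ 0
    rowLength-shape-> k<x = trans (rowLength-filter parts-decreasing _) (rowLength-tabulate-≥ part k<x)

  shape-isPartition : IsPartition (shape k u)
  shape-isPartition = record
    { decreasing = AllPairs⇒Linked (AllPairs.filter⁺ (0 <?_) parts-decreasing)
    ; positive   = all-filter (0 <?_) (List.tabulate part)
    }

  Filled≐shape : Filled k u ≐ Diagram (shape k u)
  Filled≐shape = to , from
    where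
    to : Filled k u ⊆ Diagram (shape k u)
    to {x , y} (p , x+p≡k , y+p<up) =
      subst (λ z → y < rowLength (shape k u) z) (toℕ-fromℕ< x<1+k)
        (subst (y <_) (sym (rowLength-shape t))
          (subst (λ q → y < toℕ (u ⟨$⟩ʳ q) ∸ toℕ q) p≡ (m+n≤o⇒m≤o∸n (suc y) y+p<up)))
      where
      x<1+k : x < suc (toℕ k)
      x<1+k = s≤s (≤-trans (m≤m+n x (toℕ p)) (≤-reflexive x+p≡k))
      t : Fin (suc (toℕ k))
      t = fromℕ< x<1+k
      p≡ : p ≡ position t
      p≡ = toℕ-injective (+-cancelˡ-≡ x _ _ (trans x+p≡k
             (trans (sym (position+t t)) (cong (_+ toℕ (position t)) (toℕ-fromℕ< x<1+k)))))

    from : Diagram (shape k u) ⊆ Filled k u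
    from {x , y} y<row with x <? suc (toℕ k)
    ... | no  x≮1+k = contradiction (subst (y <_) (rowLength-shape-> (≮⇒≥ x≮1+k)) y<row) n≮0
    ... | yes x<1+k =
          position t
        , trans (cong (_+ toℕ (position t)) (sym x≡)) (position+t t)
        , m≤o∸n⇒m+n≤o (suc y) (sorted-≥ (position≤k t))
            (subst (y <_) (rowLength-shape t) (subst (λ z → y < rowLength (shape k u) z) (sym x≡) y<row))
      where
      t : Fin (suc (toℕ k))
      t = fromℕ< x<1+k
      x≡ : toℕ t ≡ x
      x≡ = toℕ-fromℕ< x<1+k

  module _ {i : Fin r} (fireable : Fireable k u i) where

    private
      p : Fin (suc r)
      p = u ⟨$⟩ˡ inject₁ i

      up≡i : toℕ (u ⟨$⟩ʳ p) ≡ toℕ i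
      up≡i = trans (cong toℕ (Perm.inverseʳ u)) (toℕ-inject₁ i)

      p≤k : toℕ p ≤ toℕ k
      p≤k = proj₁ fireable

      p≤i : toℕ p ≤ toℕ i
      p≤i = ≤-trans (sorted-≥ p≤k) (≤-reflexive up≡i)

      value≢1+i : ∀ {q} → toℕ q ≤ toℕ k → u ⟨$⟩ʳ q ≢ suc i
      value≢1+i q≤k uq≡1+i = contradiction (subst (λ z → toℕ z ≤ toℕ k) (⟨$⟩ʳ≡⇒⟨$⟩ˡ≡ u uq≡1+i) q≤k) (<⇒≱ (proj₂ fireable))

      position≤k′ : ∀ {x} (q : Fin (suc r)) → x + toℕ q ≡ toℕ k → toℕ q ≤ toℕ k
      position≤k′ q x+q≡k = ≤-trans (m≤n+m _ _) (≤-reflexive x+q≡k)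

    cell-row : proj₁ (cell k u i) + toℕ p ≡ toℕ k
    cell-row = m∸n+n≡m p≤k

    cell-column : proj₂ (cell k u i) + toℕ p ≡ toℕ i
    cell-column = m∸n+n≡m p≤i

    -- Only the pair of positions holding i and i + 1 could lose its order. Fireability puts them
    -- into different blocks, while `Sorted` compares positions within one block.
    fire-sorted : Sorted k (s i · u)
    fire-sorted = record
      { below = λ a<b b≤k → s-mono-< i (below a<b b≤k) λ (_ , ub≡1+i) → value≢1+i b≤k ub≡1+i
      ; above = λ a<b k<a → s-mono-< i (above a<b k<a) λ (ua≡i , _) →
          <⇒≱ k<a (subst (λ z → toℕ z ≤ toℕ k) (sym (⟨$⟩ʳ≡⇒⟨$⟩ˡ≡ u ua≡i)) p≤k)
      }

    cell-fresh : cell k u i ∉ Filled k u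
    cell-fresh (q , row , col) with toℕ-injective (+-cancelˡ-≡ (toℕ k ∸ toℕ p) _ _ (trans row (sym cell-row)))
    ... | refl = <-irrefl (trans cell-column (sym up≡i)) col

    -- On the first block only the value at `p` changes, from i to i + 1, because i + 1 does not
    -- occur there. Hence one row grows, by one cell.
    Filled-fire : Filled k (s i · u) ≐ Filled k u ∪ ｛ cell k u i ｝
    Filled-fire = to , from
      where
      to : Filled k (s i · u) ⊆ Filled k u ∪ ｛ cell k u i ｝
      to {x , y} (q , row , col) = helper refl (s-swap i (u ⟨$⟩ʳ q)) col
        where
        helper : ∀ {a b} → u ⟨$⟩ʳ q ≡ a → Swap i a b → y + toℕ q < toℕ b →
          (x , y) ∈ Filled k u ∪ ｛ cell k u i ｝
        helper uq≡i up y+q<1+i with m≤n⇒m<n∨m≡n (s≤s⁻¹ y+q<1+i)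
        ... | inj₁ y+q<i = inj₁ (q , row , <-≤-trans y+q<i (≤-reflexive
                (trans (sym (toℕ-inject₁ i)) (cong toℕ (sym uq≡i)))))
        ... | inj₂ y+q≡i with ⟨$⟩ʳ≡⇒⟨$⟩ˡ≡ u uq≡i
        ...   | refl = inj₂ (cong₂ _,_
                (+-cancelʳ-≡ (toℕ p) _ _ (trans cell-row (sym row)))
                (+-cancelʳ-≡ (toℕ p) _ _ (trans cell-column (sym y+q≡i))))
        helper uq≡1+i down _ = contradiction uq≡1+i (value≢1+i (position≤k′ q row))
        helper refl (fixed _ _) y+q<uq = inj₁ (q , row , y+q<uq)

      from : Filled k u ∪ ｛ cell k u i ｝ ⊆ Filled k (s i · u)
      from {x , y} (inj₁ (q , row , col)) = q , row , helper refl (s-swap i (u ⟨$⟩ʳ q))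
        where
        helper : ∀ {a b} → u ⟨$⟩ʳ q ≡ a → Swap i a b → y + toℕ q < toℕ b
        helper uq≡i   up          = <-trans col (subst (λ z → toℕ z < suc (toℕ i)) (sym uq≡i) (inject₁<suc i))
        helper uq≡1+i down        = contradiction uq≡1+i (value≢1+i (position≤k′ q row))
        helper refl   (fixed _ _) = col
      from (inj₂ refl) = p , cell-row , subst (λ z → proj₂ (cell k u i) + toℕ p < toℕ z)
        (sym (trans (cong (s i ⟨$⟩ʳ_) (Perm.inverseʳ u)) (transpose-ˡ (inject₁ i) (suc i))))
        (s≤s (≤-reflexive cell-column))

  Filled-isYoungDiagram : IsYoungDiagram (Filled k u)
  Filled-isYoungDiagram = shape k u , shape-isPartition , Filled≐shape

-- Configurations along a firing sequence

δ : ∀ {n} → Fin n → Fin n → ℕ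
δ x y = if does (x ≟ y) then 1 else 0

δ-inject₁ : ∀ {n} (x y : Fin n) → δ (inject₁ x) (inject₁ y) ≡ δ x y
δ-inject₁ zero    zero    = refl
δ-inject₁ zero    (suc y) = refl
δ-inject₁ (suc x) zero    = refl
δ-inject₁ (suc x) (suc y) = δ-inject₁ x y

δ-refl : ∀ {n} (x : Fin n) → δ x x ≡ 1
δ-refl x rewrite dec-true (x ≟ x) refl = refl

δ-≢ : ∀ {n} {x y : Fin n} → x ≢ y → δ x y ≡ 0
δ-≢ {x = x} {y} x≢y rewrite dec-false (x ≟ y) x≢y = refl

lookup-increment : ∀ {n} (c : Vec ℕ n) i v →
  Vec.lookup (c [ i ]≔ suc (Vec.lookup c i)) v ≡ δ v i + Vec.lookup c v
lookup-increment (_ ∷ c) zero    zero    = refl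
lookup-increment (_ ∷ c) zero    (suc v) = refl
lookup-increment (_ ∷ c) (suc i) zero    = refl
lookup-increment (_ ∷ c) (suc i) (suc v) = lookup-increment c i v

lookup-∷ʳ-inject₁ : ∀ {n} (c : Vec ℕ n) a i → Vec.lookup (c ∷ʳ a) (inject₁ i) ≡ Vec.lookup c i
lookup-∷ʳ-inject₁ (_ ∷ c) a zero    = refl
lookup-∷ʳ-inject₁ (_ ∷ c) a (suc i) = lookup-∷ʳ-inject₁ c a i

[]≔-∷ʳ : ∀ {n} (c : Vec ℕ n) i a b → (c [ i ]≔ b) ∷ʳ a ≡ (c ∷ʳ a) [ inject₁ i ]≔ b
[]≔-∷ʳ (_ ∷ c) zero    a b = refl
[]≔-∷ʳ (x ∷ c) (suc i) a b = cong (x ∷_) ([]≔-∷ʳ c i a b)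

-- The `δ` terms detect whether `i` is the left or the right neighbour of `v`. The entry c_i has
-- index `suc i` in `0 ∷ c` and `inject₁ i` in `c ∷ʳ 0`.
neighbourSum-increment : ∀ {r} (k : Fin r) c i v →
  neighbourSum k (c [ i ]≔ suc (Vec.lookup c i)) v
    ≡ δ (inject₁ v) (suc i) + δ (suc v) (inject₁ i) + neighbourSum k c v
neighbourSum-increment k c i v = begin
  L′ + R′ + ε                ≡⟨ cong₂ (λ a b → a + b + ε) (lookup-increment (0 ∷ c) (suc i) (inject₁ v)) right ⟩
  (dI + L) + (dS + R) + ε    ≡⟨ rearrange dI L dS R ε ⟩
  dI + dS + (L + R + ε)      ∎
  where
  open ≡-Reasoning
  L L′ R R′ ε dI dS : ℕ
  L = Vec.lookup (0 ∷ c) (inject₁ v)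
  R = Vec.lookup (c ∷ʳ 0) (suc v)
  L′ = Vec.lookup (0 ∷ (c [ i ]≔ suc (Vec.lookup c i))) (inject₁ v)
  R′ = Vec.lookup ((c [ i ]≔ suc (Vec.lookup c i)) ∷ʳ 0) (suc v)
  ε = if does (v ≟ k) then 1 else 0
  dI = δ (inject₁ v) (suc i)
  dS = δ (suc v) (inject₁ i)
  right : R′ ≡ dS + R
  right = begin
    R′ ≡⟨ cong (λ z → Vec.lookup z (suc v)) ([]≔-∷ʳ c i 0 (suc (Vec.lookup c i))) ⟩
    Vec.lookup ((c ∷ʳ 0) [ inject₁ i ]≔ suc (Vec.lookup c i)) (suc v)
      ≡⟨ cong (λ z → Vec.lookup ((c ∷ʳ 0) [ inject₁ i ]≔ suc z) (suc v)) (lookup-∷ʳ-inject₁ c 0 i) ⟨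
    Vec.lookup ((c ∷ʳ 0) [ inject₁ i ]≔ suc (Vec.lookup (c ∷ʳ 0) (inject₁ i))) (suc v)
      ≡⟨ lookup-increment (c ∷ʳ 0) (inject₁ i) (suc v) ⟩
    dS + R ∎
  rearrange : ∀ a b c d e → (a + b) + (c + d) + e ≡ a + c + (b + d + e)
  rearrange = solve-∀

-- The indicator of A, as a number so that it can enter the identity `Balanced`.
occupied : ∀ {r} → Fin r → Permutation′ (suc r) → Fin (suc r) → ℕ
occupied k u x = if does (toℕ (u ⟨$⟩ˡ x) ≤? toℕ k) then 1 else 0

occupied-≤ : ∀ {r} (k : Fin r) u x → toℕ (u ⟨$⟩ˡ x) ≤ toℕ k → occupied k u x ≡ 1
occupied-≤ k u x le rewrite dec-true (toℕ (u ⟨$⟩ˡ x) ≤? toℕ k) le = refl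

occupied-> : ∀ {r} (k : Fin r) u x → toℕ k < toℕ (u ⟨$⟩ˡ x) → occupied k u x ≡ 0
occupied-> k u x gt rewrite dec-false (toℕ (u ⟨$⟩ˡ x) ≤? toℕ k) (<⇒≱ gt) = refl

-- c_v counts the cells on the diagonal v - k, so that c_{v-1} + c_{v+1} + ε_v - 2 c_v
-- is a second difference, which only depends on whether u takes the values v and
-- v + 1 at its first k positions.
Balanced : ∀ {r} → Fin r → Permutation′ (suc r) → Config r → Set
Balanced k u c = ∀ v →
  neighbourSum k c v + occupied k u (suc v) ≡ 2 * Vec.lookup c v + occupied k u (inject₁ v)

replicate-∷ʳ : ∀ n (a : ℕ) → Vec.replicate n a ∷ʳ a ≡ Vec.replicate (suc n) a
replicate-∷ʳ zero    a = refl
replicate-∷ʳ (suc n) a = cong (a ∷_) (replicate-∷ʳ n a)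

-- For the identity, A is an initial segment. Its indicator drops only between `inject₁ k` and
-- `suc k`, where the active vertex contributes ε = 1.
Balanced-start : ∀ {r} (k : Fin r) → Balanced k Perm.id (Vec.replicate r 0)
Balanced-start {r} k v
  rewrite lookup-replicate (inject₁ v) 0 | replicate-∷ʳ r 0 | lookup-replicate v 0
  with <-cmp v k
... | tri< v<k v≢k _ rewrite dec-false (v ≟ k) v≢k
        | occupied-≤ k Perm.id (suc v) v<k
        | occupied-≤ k Perm.id (inject₁ v) (≤-trans (≤-reflexive (toℕ-inject₁ v)) (<⇒≤ v<k)) = refl
... | tri≈ _ refl _ rewrite dec-true (v ≟ v) refl
        | occupied-> v Perm.id (suc v) (n<1+n _)
        | occupied-≤ v Perm.id (inject₁ v) (≤-reflexive (toℕ-inject₁ v)) = refl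
... | tri> _ v≢k k<v rewrite dec-false (v ≟ k) v≢k
        | occupied-> k Perm.id (suc v) (<-trans k<v (n<1+n _))
        | occupied-> k Perm.id (inject₁ v) (≤-trans k<v (≤-reflexive (sym (toℕ-inject₁ v)))) = refl

module _ {r} {k : Fin r} {u : Permutation′ (suc r)} {c : Config r} (balanced : Balanced k u c) {i : Fin r} where

  sad⇒fireable : Sad k c i → Fireable k u i
  sad⇒fireable sad with toℕ (u ⟨$⟩ˡ inject₁ i) ≤? toℕ k | toℕ (u ⟨$⟩ˡ suc i) ≤? toℕ k
  ... | yes p≤k | no q≰k = p≤k , ≰⇒> q≰k
  ... | no p≰k  | _      = contradiction sad (≤⇒≯ (≤-trans (m≤m+n _ _)
          (≤-reflexive (trans (balanced i) (trans (cong (_+_ (2 * Vec.lookup c i)) (occupied-> k u (inject₁ i) (≰⇒> p≰k))) (+-identityʳ _))))))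
  ... | yes p≤k | yes q≤k = contradiction sad (<-irrefl (sym (+-cancelʳ-≡ 1 _ _
          (subst₂ (λ a b → neighbourSum k c i + a ≡ 2 * Vec.lookup c i + b)
            (occupied-≤ k u (suc i) q≤k) (occupied-≤ k u (inject₁ i) p≤k) (balanced i)))))

  module _ (fireable : Fireable k u i) where

    fireable⇒neighbourSum : neighbourSum k c i ≡ suc (2 * Vec.lookup c i)
    fireable⇒neighbourSum = begin
      neighbourSum k c i                            ≡⟨ +-identityʳ _ ⟨
      neighbourSum k c i + 0                        ≡⟨ cong (neighbourSum k c i +_) (occupied-> k u (suc i) (proj₂ fireable)) ⟨
      neighbourSum k c i + occupied k u (suc i)     ≡⟨ balanced i ⟩
      2 * Vec.lookup c i + occupied k u (inject₁ i) ≡⟨ cong (2 * Vec.lookup c i +_) (occupied-≤ k u (inject₁ i) (proj₁ fireable)) ⟩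
      2 * Vec.lookup c i + 1                        ≡⟨ +-comm _ 1 ⟩
      suc (2 * Vec.lookup c i)                      ∎
      where open ≡-Reasoning

    fireable⇒sad : Sad k c i
    fireable⇒sad = ≤-reflexive (sym fireable⇒neighbourSum)

    -- The neighbour sum is 2 c_i + 1, so firing adds exactly one, matching the single new cell.
    fire≡increment : fire k c i ≡ c [ i ]≔ suc (Vec.lookup c i)
    fire≡increment = cong (c [ i ]≔_) (begin
      neighbourSum k c i ∸ a    ≡⟨ cong (_∸ a) fireable⇒neighbourSum ⟩
      suc (2 * a) ∸ a           ≡⟨ cong (_∸ a) (double a) ⟩
      suc a + a ∸ a             ≡⟨ m+n∸n≡m (suc a) a ⟩
      suc a                     ∎)
      where
      open ≡-Reasoning
      a : ℕ
      a = Vec.lookup c i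
      double : ∀ a → suc (2 * a) ≡ suc a + a
      double = solve-∀

    -- Firing replaces i by i + 1 in A. The corrections are distributed over both sides to avoid
    -- subtraction.
    occupied-fire : ∀ x → occupied k (s i · u) x + δ x (inject₁ i) ≡ occupied k u x + δ x (suc i)
    occupied-fire x = aux (subst (Swap i (s i ⟨$⟩ˡ x)) (Perm.inverseʳ (s i)) (s-swap i (s i ⟨$⟩ˡ x)))
      where
      aux : ∀ {y x} → Swap i y x → occupied k u y + δ x (inject₁ i) ≡ occupied k u x + δ x (suc i)
      aux up = begin
        occupied k u (inject₁ i) + δ (suc i) (inject₁ i)
          ≡⟨ cong₂ _+_ (occupied-≤ k u (inject₁ i) (proj₁ fireable)) (δ-≢ (inject₁≢suc i ∘ sym)) ⟩
        0 + 1
          ≡⟨ cong₂ _+_ (occupied-> k u (suc i) (proj₂ fireable)) (δ-refl (suc i)) ⟨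
        occupied k u (suc i) + δ (suc i) (suc i) ∎
        where open ≡-Reasoning
      aux down = begin
        occupied k u (suc i) + δ (inject₁ i) (inject₁ i)
          ≡⟨ cong₂ _+_ (occupied-> k u (suc i) (proj₂ fireable)) (δ-refl (inject₁ i)) ⟩
        1 + 0
          ≡⟨ cong₂ _+_ (occupied-≤ k u (inject₁ i) (proj₁ fireable)) (δ-≢ (inject₁≢suc i)) ⟨
        occupied k u (inject₁ i) + δ (inject₁ i) (suc i) ∎
        where open ≡-Reasoning
      aux (fixed {x} ≢i ≢1+i) = cong (occupied k u x +_) (trans (δ-≢ ≢i) (sym (δ-≢ ≢1+i)))

    -- The term `dS` for i = v + 1 is absorbed by the change of the indicator at `suc v`, and `dI`
    -- for v = i + 1 by the change at `inject₁ v`. Each absorption leaves one `δ v i`, and the two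
    -- together are the doubled increment of c_v.
    fire-balanced : Balanced k (s i · u) (fire k c i)
    fire-balanced v rewrite fire≡increment = begin
      neighbourSum k c′ v + B′         ≡⟨ cong (_+ B′) (neighbourSum-increment k c i v) ⟩
      dI + dS + N + B′                 ≡⟨ rearrange₁ dI dS N B′ ⟩
      dI + N + (B′ + dS)               ≡⟨ cong (dI + N +_) (occupied-fire (suc v)) ⟩
      dI + N + (A′ + dV)               ≡⟨ rearrange₂ dI N A′ dV ⟩
      dI + dV + (N + A′)               ≡⟨ cong (dI + dV +_) (balanced v) ⟩
      dI + dV + (2 * a + A)            ≡⟨ rearrange₃ dI dV a A ⟩
      dV + 2 * a + (A + dI)            ≡⟨ cong (dV + 2 * a +_) (occupied-fire (inject₁ v)) ⟨
      dV + 2 * a + (B + δ (inject₁ v) (inject₁ i)) ≡⟨ cong (λ d → dV + 2 * a + (B + d)) (δ-inject₁ v i) ⟩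
      dV + 2 * a + (B + dV)            ≡⟨ rearrange₄ dV a B ⟩
      2 * (dV + a) + B                 ≡⟨ cong (λ z → 2 * z + B) (lookup-increment c i v) ⟨
      2 * Vec.lookup c′ v + B          ∎
      where
      open ≡-Reasoning
      c′ : Config r
      c′ = c [ i ]≔ suc (Vec.lookup c i)
      a A A′ B B′ N dI dS dV : ℕ
      a = Vec.lookup c v
      A = occupied k u (inject₁ v)
      A′ = occupied k u (suc v)
      B = occupied k (s i · u) (inject₁ v)
      B′ = occupied k (s i · u) (suc v)
      N = neighbourSum k c v
      dI = δ (inject₁ v) (suc i)
      dS = δ (suc v) (inject₁ i)
      dV = δ v i
      rearrange₁ : ∀ x y z w → x + y + z + w ≡ x + z + (w + y)
      rearrange₁ = solve-∀
      rearrange₂ : ∀ x y z w → x + y + (z + w) ≡ x + w + (y + z)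
      rearrange₂ = solve-∀
      rearrange₃ : ∀ x y z w → x + y + (2 * z + w) ≡ y + 2 * z + (w + x)
      rearrange₃ = solve-∀
      rearrange₄ : ∀ x y z → x + 2 * y + (z + x) ≡ 2 * (x + y) + z
      rearrange₄ = solve-∀

-- Validity expressed by permutations alone; `Balanced` translates between this and `ValidFrom`.
AllFireable : ∀ {r l} → Fin r → Permutation′ (suc r) → Vec (Fin r) l → Set
AllFireable k u []       = ⊤
AllFireable k u (i ∷ is) = Fireable k u i × AllFireable k (s i · u) is

valid⇒fireable : ∀ {r l} {k : Fin r} {u c} → Balanced k u c → (is : Vec (Fin r) l) →
  ValidFrom k c is → AllFireable k u is
valid⇒fireable balanced []       _             = tt
valid⇒fireable {u = u} balanced (i ∷ is) (sad , valid) =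
  fireable , valid⇒fireable {u = s i · u} (fire-balanced {u = u} balanced fireable) is valid
  where fireable = sad⇒fireable {u = u} balanced sad

fireable⇒valid : ∀ {r l} {k : Fin r} {u c} → Balanced k u c → (is : Vec (Fin r) l) →
  AllFireable k u is → ValidFrom k c is
fireable⇒valid balanced []       _                  = tt
fireable⇒valid {u = u} balanced (i ∷ is) (fireable , rest) =
  fireable⇒sad {u = u} balanced fireable ,
  fireable⇒valid {u = s i · u} (fire-balanced {u = u} balanced fireable) is rest

-- The cells filled along a firing sequence

cells : ∀ {r l} → Fin r → Permutation′ (suc r) → Vec (Fin r) l → Vec Cell l
cells k u []       = []
cells k u (i ∷ is) = cell k u i ∷ cells k (s i · u) is

Range : ∀ {l} → Vec Cell l → Pred Cell 0ℓ
Range ps p = Σ[ j ∈ Fin _ ] Vec.lookup ps j ≡ p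

-- The condition on a sequence of cells for labelling them in this order to give a
-- standard filling when D is already filled.
record Standard {l} (D : Pred Cell 0ℓ) (ps : Vec Cell l) : Set where
  field
    fresh    : ∀ j → Vec.lookup ps j ∉ D
    distinct : ∀ j j′ → Vec.lookup ps j ≡ Vec.lookup ps j′ → j ≡ j′
    closed   : ∀ j {x y} → x ≤ proj₁ (Vec.lookup ps j) → y ≤ proj₂ (Vec.lookup ps j) →
               (x , y) ∈ D ⊎ Σ[ j′ ∈ Fin l ] toℕ j′ ≤ toℕ j × Vec.lookup ps j′ ≡ (x , y)

Filled-lower : ∀ {r} {k : Fin r} {u} → Sorted k u → ∀ {x x′ y y′} → x′ ≤ x → y′ ≤ y →
  (x , y) ∈ Filled k u → (x′ , y′) ∈ Filled k u
Filled-lower sorted = youngDiagram-lower (Filled-isYoungDiagram sorted)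

⊖-cross : ∀ a b c d → a ⊖ b ≡ c ⊖ d → a + d ≡ c + b
⊖-cross a b c d eq = ℤ.+-injective (begin
  ℤ.+ (a + d)                ≡⟨ clear a b d ⟨
  (a ⊖ b) ℤ.+ ℤ.+ (b + d)    ≡⟨ cong₂ (λ z n → z ℤ.+ ℤ.+ n) eq (+-comm b d) ⟩
  (c ⊖ d) ℤ.+ ℤ.+ (d + b)    ≡⟨ clear c d b ⟩
  ℤ.+ (c + b)                ∎)
  where
  open ≡-Reasoning
  clear : ∀ a b d → (a ⊖ b) ℤ.+ ℤ.+ (b + d) ≡ ℤ.+ (a + d)
  clear a b d = begin
    (a ⊖ b) ℤ.+ ℤ.+ (b + d)  ≡⟨ distribˡ-⊖-+-pos (b + d) a b ⟩
    (a + (b + d)) ⊖ b        ≡⟨ cong₂ _⊖_ (trans (sym (+-assoc a b d)) (trans (cong (_+ d) (+-comm a b)) (+-assoc b a d))) (sym (+-identityʳ b)) ⟩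
    (b + (a + d)) ⊖ (b + 0)  ≡⟨ +-cancelˡ-⊖ b (a + d) 0 ⟩
    (a + d) ⊖ 0              ≡⟨ ℤ.⊖-≥ z≤n ⟩
    ℤ.+ (a + d)              ∎

cell-content : ∀ {r} {k : Fin r} {u i} → Sorted k u → Fireable k u i →
  proj₂ (cell k u i) ⊖ proj₁ (cell k u i) ≡ toℕ i ⊖ toℕ k
cell-content {k = k} {u} {i} sorted fireable = begin
  y ⊖ x              ≡⟨ +-cancelˡ-⊖ p y x ⟨
  (p + y) ⊖ (p + x)  ≡⟨ cong₂ _⊖_ (trans (+-comm p y) (cell-column sorted fireable)) (trans (+-comm p x) (cell-row sorted fireable)) ⟩
  toℕ i ⊖ toℕ k      ∎
  where
  open ≡-Reasoning
  x y p : ℕ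
  x = proj₁ (cell k u i)
  y = proj₂ (cell k u i)
  p = toℕ (u ⟨$⟩ˡ inject₁ i)

-- Along a diagonal, rows and columns grow together, so any two cells of equal content are
-- comparable.
same-content-≤ : ∀ {x y x′ y′} c d → y ⊖ x ≡ c ⊖ d → y′ ⊖ x′ ≡ c ⊖ d → x ≤ x′ → y ≤ y′
same-content-≤ {x} {y} {x′} {y′} c d eq eq′ x≤x′ = +-cancelʳ-≤ x′ _ _
  (≤-trans (≤-reflexive (⊖-cross y x y′ x′ (trans eq (sym eq′)))) (+-monoʳ-≤ y′ x≤x′))

≐-∪ : ∀ {D E : Pred Cell 0ℓ} {p} → D ≐ E → D ∪ ｛ p ｝ ≐ E ∪ ｛ p ｝
≐-∪ (D⊆E , E⊆D) = Sum.map₁ D⊆E , Sum.map₁ E⊆D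

-- For uniqueness, let q be another addable cell of the same content. Of p and q, one lies weakly
-- above and to the left of the other. Adding the latter gives a Young diagram, which must contain
-- the former; as that cell was not yet filled, the two coincide.
places : ∀ {r l} {k : Fin r} {u D} → Sorted k u → D ≐ Filled k u → (is : Vec (Fin r) l) →
  AllFireable k u is → Places k D is (cells k u is)
places sorted D≐ [] _ = tt
places {k = k} {u} {D} sorted D≐ (i ∷ is) (fireable , rest) =
  ((((cell-fresh sorted fireable ∘ proj₁ D≐) , young) , cell-content sorted fireable) , unique) ,
  places sorted′ D′≐ is rest
  where
  p : Cell
  p = cell k u i

  sorted′ : Sorted k (s i · u)
  sorted′ = fire-sorted sorted fireable

  D′≐ : D ∪ ｛ p ｝ ≐ Filled k (s i · u)
  D′≐ = ≐-trans (≐-∪ D≐) (≐-sym (Filled-fire sorted fireable))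

  young : IsYoungDiagram (D ∪ ｛ p ｝)
  young = _ , shape-isPartition sorted′ , ≐-trans D′≐ (Filled≐shape sorted′)

  unique : ∀ q → AddableAt k D i q → q ≡ p
  unique q@(x , y) ((q∉D , young-q) , content) with ≤-total x (proj₁ p)
  ... | inj₁ x≤ with proj₂ D′≐ (Filled-lower sorted′ x≤
                       (same-content-≤ (toℕ i) (toℕ k) content (cell-content sorted fireable) x≤)
                       (proj₁ D′≐ (inj₂ refl)))
  ...   | inj₁ q∈D = contradiction q∈D q∉D
  ...   | inj₂ p≡q = sym p≡q
  unique q@(x , y) ((q∉D , young-q) , content) | inj₂ ≤x
    with youngDiagram-lower young-q ≤x
           (same-content-≤ (toℕ i) (toℕ k) (cell-content sorted fireable) content ≤x) (inj₂ refl)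
  ...   | inj₁ p∈D = contradiction (proj₁ D≐ p∈D) (cell-fresh sorted fireable)
  ...   | inj₂ q≡p = q≡p

product-sorted : ∀ {r l} {k : Fin r} {u} → Sorted k u → (is : Vec (Fin r) l) →
  AllFireable k u is → Sorted k (product is · u)
-- The fields of `Sorted` mention only values of the permutation, so rebuilding the record passes
-- from `u` to `product [] · u`, and in the next clause reassociates the product.
product-sorted sorted []       _                 = record { Sorted sorted }
product-sorted sorted (i ∷ is) (fireable , rest) =
  record { Sorted (product-sorted (fire-sorted sorted fireable) is rest) }

Filled-product : ∀ {r l} {k : Fin r} {u} → Sorted k u → (is : Vec (Fin r) l) →
  AllFireable k u is → Filled k (product is · u) ≐ Filled k u ∪ Range (cells k u is)
Filled-product sorted [] _ = inj₁ , λ { (inj₁ p∈D) → p∈D }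
Filled-product {k = k} {u} sorted (i ∷ is) (fireable , rest) = to , from
  where
  ih : Filled k (product is · (s i · u)) ≐ Filled k (s i · u) ∪ Range (cells k (s i · u) is)
  ih = Filled-product (fire-sorted sorted fireable) is rest

  to : Filled k (product (i ∷ is) · u) ⊆ Filled k u ∪ Range (cells k u (i ∷ is))
  to p∈ with proj₁ ih p∈
  ... | inj₂ (j , eq) = inj₂ (suc j , eq)
  ... | inj₁ p∈′ with proj₁ (Filled-fire sorted fireable) p∈′
  ...   | inj₁ p∈D = inj₁ p∈D
  ...   | inj₂ eq  = inj₂ (zero , eq)

  from : Filled k u ∪ Range (cells k u (i ∷ is)) ⊆ Filled k (product (i ∷ is) · u)
  from (inj₁ p∈D)         = proj₂ ih (inj₁ (proj₂ (Filled-fire sorted fireable) (inj₁ p∈D)))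
  from (inj₂ (zero , eq)) = proj₂ ih (inj₁ (proj₂ (Filled-fire sorted fireable) (inj₂ eq)))
  from (inj₂ (suc j , eq)) = proj₂ ih (inj₂ (j , eq))

-- After each firing the filled cells form a Young diagram again, so a cell above and to the left of
-- the new one was filled before or is the new one.
cells-standard : ∀ {r l} {k : Fin r} {u} → Sorted k u → (is : Vec (Fin r) l) →
  AllFireable k u is → Standard (Filled k u) (cells k u is)
cells-standard sorted [] _ = record { fresh = λ () ; distinct = λ () ; closed = λ () }
cells-standard {k = k} {u} sorted (i ∷ is) (fireable , rest) = record
  { fresh    = λ where
      zero    → cell-fresh sorted fireable
      (suc j) → Standard.fresh ih j ∘ proj₂ filled ∘ inj₁
  ; distinct = λ where
      zero    zero     _  → refl
      zero    (suc j′) eq → contradiction (proj₂ filled (inj₂ eq)) (Standard.fresh ih j′)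
      (suc j) zero     eq → contradiction (proj₂ filled (inj₂ (sym eq))) (Standard.fresh ih j)
      (suc j) (suc j′) eq → cong suc (Standard.distinct ih j j′ eq)
  ; closed   = λ where
      zero    x≤ y≤ → earlier z≤n (Filled-lower sorted′ x≤ y≤ (proj₂ filled (inj₂ refl)))
      (suc j) x≤ y≤ → later (Standard.closed ih j x≤ y≤)
  }
  where
  sorted′ : Sorted k (s i · u)
  sorted′ = fire-sorted sorted fireable

  ih : Standard (Filled k (s i · u)) (cells k (s i · u) is)
  ih = cells-standard sorted′ is rest

  filled : Filled k (s i · u) ≐ Filled k u ∪ ｛ cell k u i ｝
  filled = Filled-fire sorted fireable

  ps : Vec Cell _
  ps = cells k u (i ∷ is)

  earlier : ∀ {n p} → 0 ≤ n → p ∈ Filled k (s i · u) →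
    p ∈ Filled k u ⊎ Σ[ j′ ∈ Fin _ ] toℕ j′ ≤ n × Vec.lookup ps j′ ≡ p
  earlier 0≤n p∈ = Sum.map₂ (λ eq → zero , 0≤n , eq) (proj₁ filled p∈)

  later : ∀ {n p} →
    p ∈ Filled k (s i · u) ⊎ Σ[ j′ ∈ Fin _ ] toℕ j′ ≤ n × Vec.lookup (cells k (s i · u) is) j′ ≡ p →
    p ∈ Filled k u ⊎ Σ[ j′ ∈ Fin _ ] toℕ j′ ≤ suc n × Vec.lookup ps j′ ≡ p
  later (inj₁ p∈)            = earlier z≤n p∈
  later (inj₂ (j′ , j′≤ , eq)) = inj₂ (suc j′ , s≤s j′≤ , eq)

-- The content of each new cell determines the vertex that was fired.
cells-injective : ∀ {r l} {k : Fin r} {u} → Sorted k u → (is is′ : Vec (Fin r) l) →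
  AllFireable k u is → AllFireable k u is′ →
  (∀ j → Vec.lookup (cells k u is) j ≡ Vec.lookup (cells k u is′) j) → is ≡ is′
cells-injective sorted [] [] _ _ _ = refl
cells-injective {k = k} {u} sorted (i ∷ is) (i′ ∷ is′) (fireable , rest) (fireable′ , rest′) eq
  with toℕ-injective (+-cancelʳ-≡ (toℕ k) _ _ (⊖-cross (toℕ i) (toℕ k) (toℕ i′) (toℕ k)
         (trans (sym (cell-content sorted fireable))
           (trans (cong (λ p → proj₂ p ⊖ proj₁ p) (eq zero)) (cell-content sorted fireable′)))))
... | refl = cong (i ∷_)
        (cells-injective (fire-sorted sorted fireable) is is′ rest rest′ (eq ∘ suc))

-- Every standard order of cells comes from firing

-- The k × (n - k) rectangle.
OnBoard : ∀ {r} → Fin r → Pred Cell 0ℓ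
OnBoard {r} k (x , y) =
  Σ[ i ∈ Fin r ] Σ[ p ∈ Fin (suc r) ] x + toℕ p ≡ toℕ k × y + toℕ p ≡ toℕ i

Filled⊆OnBoard : ∀ {r} (k : Fin r) u → Filled k u ⊆ OnBoard k
Filled⊆OnBoard {r} k u {x , y} (p , row , col) =
  fromℕ< y+p<r , p , row , sym (toℕ-fromℕ< y+p<r)
  where
  y+p<r : y + toℕ p < r
  y+p<r = <-≤-trans col (s≤s⁻¹ (toℕ<n (u ⟨$⟩ʳ p)))

module _ {r} {k : Fin r} {u : Permutation′ (suc r)} (sorted : Sorted k u) where

  -- The vertex is read off from the content of `q`. That nothing is missing to the left of `q`
  -- forces u(p) = i, and that nothing is missing above it forces i + 1 out of the first block.
  standard-head : ∀ {l q} {qs : Vec Cell l} → Standard (Filled k u) (q ∷ qs) → q ∈ OnBoard k →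
    Σ[ i ∈ Fin r ] Fireable k u i × cell k u i ≡ q
  standard-head {q = x , y} {qs} standard (i , p , row , col) = i , (p≤k′ , ≰⇒> p′≰k) , cell≡
    where
    open Standard standard
    up≤y+p : toℕ (u ⟨$⟩ʳ p) ≤ y + toℕ p
    up≤y+p = ≮⇒≥ λ col′ → fresh zero (p , row , col′)

    p≤k : toℕ p ≤ toℕ k
    p≤k = ≤-trans (m≤n+m _ x) (≤-reflexive row)

    p≤up : toℕ p ≤ toℕ (u ⟨$⟩ʳ p)
    p≤up = sorted-≥ sorted p≤k

    -- The first free cell of row `x` lies weakly to the left of `q`, so by `closed` it can only be
    -- `q` itself.
    up≡i : u ⟨$⟩ʳ p ≡ inject₁ i
    up≡i with closed zero {x} {toℕ (u ⟨$⟩ʳ p) ∸ toℕ p} ≤-refl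
                (≤-trans (∸-monoˡ-≤ (toℕ p) up≤y+p) (≤-reflexive (m+n∸n≡m y (toℕ p))))
    ... | inj₁ (p′ , row′ , col′) with toℕ-injective (+-cancelˡ-≡ x _ _ (trans row′ (sym row)))
    ...   | refl = contradiction col′ (<-irrefl (m∸n+n≡m p≤up))
    up≡i | inj₂ (zero , _ , eq) = toℕ-injective (begin
      toℕ (u ⟨$⟩ʳ p)                   ≡⟨ m∸n+n≡m p≤up ⟨
      toℕ (u ⟨$⟩ʳ p) ∸ toℕ p + toℕ p   ≡⟨ cong (_+ toℕ p) (cong proj₂ eq) ⟨
      y + toℕ p                        ≡⟨ col ⟩
      toℕ i                            ≡⟨ toℕ-inject₁ i ⟨
      toℕ (inject₁ i)                  ∎)
      where open ≡-Reasoning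

    p≡ : p ≡ u ⟨$⟩ˡ inject₁ i
    p≡ = ⟨$⟩ʳ≡⇒⟨$⟩ˡ≡ u up≡i

    p≤k′ : toℕ (u ⟨$⟩ˡ inject₁ i) ≤ toℕ k
    p≤k′ = subst (λ z → toℕ z ≤ toℕ k) p≡ p≤k

    p′ : Fin (suc r)
    p′ = u ⟨$⟩ˡ suc i

    up′≡1+i : u ⟨$⟩ʳ p′ ≡ suc i
    up′≡1+i = Perm.inverseʳ u

    -- The cell above q would be missing.
    p′≰k : ¬ (toℕ p′ ≤ toℕ k)
    p′≰k p′≤k with <-cmp p p′
    ... | tri≈ _ refl _ = inject₁≢suc i (trans (sym up≡i) up′≡1+i)
    ... | tri> _ _ p′<p = <-asym (inject₁<suc i)
            (subst₂ Fin._<_ up′≡1+i up≡i (Sorted.below sorted p′<p p≤k))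
    ... | tri< p<p′ _ _ with closed zero {toℕ k ∸ toℕ p′} {y} x′≤x ≤-refl
      where
      x′≤x : toℕ k ∸ toℕ p′ ≤ x
      x′≤x = ≤-trans (∸-monoʳ-≤ (toℕ k) (<⇒≤ p<p′))
               (≤-reflexive (trans (cong (_∸ toℕ p) (sym row)) (m+n∸n≡m x (toℕ p))))
    ...   | inj₁ (p″ , row″ , col″)
            with toℕ-injective (+-cancelˡ-≡ (toℕ k ∸ toℕ p′) _ _ (trans row″ (sym (m∸n+n≡m p′≤k))))
    ...     | refl = <⇒≱ p<p′ (+-cancelˡ-≤ y _ _ (≤-trans
                (s≤s⁻¹ (subst (λ z → y + toℕ p′ < toℕ z) up′≡1+i col″)) (≤-reflexive (sym col))))
    p′≰k p′≤k | tri< p<p′ _ _ | inj₂ (zero , _ , eq) = <-irrefl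
            (+-cancelˡ-≡ x _ _ (trans row (sym (trans (cong (_+ toℕ p′) (cong proj₁ eq)) (m∸n+n≡m p′≤k)))))
            p<p′

    cell≡ : cell k u i ≡ (x , y)
    cell≡ = trans (cong (λ z → toℕ k ∸ toℕ z , toℕ i ∸ toℕ z) (sym p≡)) (cong₂ _,_
      (trans (cong (_∸ toℕ p) (sym row)) (m+n∸n≡m x (toℕ p)))
      (trans (cong (_∸ toℕ p) (sym col)) (m+n∸n≡m y (toℕ p))))

standard-tail : ∀ {l D D′ q} {qs : Vec Cell l} → D′ ≐ D ∪ ｛ q ｝ → Standard D (q ∷ qs) → Standard D′ qs
standard-tail {D = D} {D′} {q} {qs} (D′⊆ , ⊆D′) standard = record
  { fresh    = λ j → fresh′ j ∘ D′⊆
  ; distinct = λ j j′ eq → Fin.suc-injective (distinct (suc j) (suc j′) eq)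
  ; closed   = λ j x≤ y≤ → closed′ (closed (suc j) x≤ y≤)
  }
  where
  open Standard standard
  fresh′ : ∀ j → Vec.lookup qs j ∉ D ∪ ｛ q ｝
  fresh′ j (inj₁ ∈D) = fresh (suc j) ∈D
  fresh′ j (inj₂ eq) with () ← distinct zero (suc j) eq

  closed′ : ∀ {n p} →
    p ∈ D ⊎ Σ[ j′ ∈ Fin _ ] toℕ j′ ≤ suc n × Vec.lookup (q ∷ qs) j′ ≡ p →
    p ∈ D′ ⊎ Σ[ j′ ∈ Fin _ ] toℕ j′ ≤ n × Vec.lookup qs j′ ≡ p
  closed′ (inj₁ p∈D)                   = inj₁ (⊆D′ (inj₁ p∈D))
  closed′ (inj₂ (zero , _ , eq))       = inj₁ (⊆D′ (inj₂ eq))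
  closed′ (inj₂ (suc j′ , s≤s j′≤ , eq)) = inj₂ (j′ , j′≤ , eq)

standard⇒cells : ∀ {r l} {k : Fin r} {u} → Sorted k u → (qs : Vec Cell l) →
  Standard (Filled k u) qs → (∀ j → Vec.lookup qs j ∈ OnBoard k) →
  Σ[ is ∈ Vec (Fin r) l ] AllFireable k u is × cells k u is ≡ qs
standard⇒cells sorted [] _ _ = [] , tt , refl
standard⇒cells {k = k} {u} sorted (q ∷ qs) standard onBoard
  with standard-head sorted standard (onBoard zero)
... | i , fireable , refl
  with standard⇒cells (fire-sorted sorted fireable) qs
         (standard-tail (Filled-fire sorted fireable) standard) (onBoard ∘ suc)
...   | is , rest , refl = i ∷ is , (fireable , rest) , refl

-- A sorted permutation is determined by its diagram

-- Applied to a bijection and to its inverse, both increasing, this shows that they are the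
-- identity.
increasing⇒≥ : ∀ {n} (g : Fin (suc n) → Fin (suc n)) → (∀ {p q} → p Fin.< q → g p Fin.< g q) →
  ∀ p → toℕ p ≤ toℕ (g p)
increasing⇒≥ g increasing = <-weakInduction (λ p → toℕ p ≤ toℕ (g p)) z≤n λ i ih →
  ≤-<-trans (≤-trans (≤-reflexive (sym (toℕ-inject₁ i))) ih) (increasing (inject₁<suc i))

module _ {r} {k : Fin r} where

  -- If v(p) were smaller than u(p), the first free cell of `v` in the row of `p` would be filled
  -- for `u`.
  Filled-⊆⇒≤ : ∀ {u v} → Sorted k v → Filled k u ⊆ Filled k v → ∀ {p} → toℕ p ≤ toℕ k →
    toℕ (u ⟨$⟩ʳ p) ≤ toℕ (v ⟨$⟩ʳ p)
  Filled-⊆⇒≤ {u} {v} sorted-v u⊆v {p} p≤k = ≮⇒≥ λ vp<up →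
    excluded (u⊆v (p , m∸n+n≡m p≤k , ≤-<-trans (≤-reflexive y+p≡vp) vp<up))
    where
    y+p≡vp : toℕ (v ⟨$⟩ʳ p) ∸ toℕ p + toℕ p ≡ toℕ (v ⟨$⟩ʳ p)
    y+p≡vp = m∸n+n≡m (sorted-≥ sorted-v p≤k)

    excluded : (toℕ k ∸ toℕ p , toℕ (v ⟨$⟩ʳ p) ∸ toℕ p) ∉ Filled k v
    excluded (p′ , row , col)
      with toℕ-injective (+-cancelˡ-≡ (toℕ k ∸ toℕ p) _ _ (trans row (sym (m∸n+n≡m p≤k))))
    ... | refl = <-irrefl y+p≡vp col

  module _ {u v} (sorted-u : Sorted k u) (sorted-v : Sorted k v)
           (agree : ∀ {p} → toℕ p ≤ toℕ k → u ⟨$⟩ʳ p ≡ v ⟨$⟩ʳ p) where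

    private
      g : Fin (suc r) → Fin (suc r)
      g p = v ⟨$⟩ˡ (u ⟨$⟩ʳ p)

      g-below : ∀ {p} → toℕ p ≤ toℕ k → p ≡ g p
      g-below p≤k = ⟨$⟩ʳ≡⇒⟨$⟩ˡ≡ v (sym (agree p≤k))

      g-above : ∀ {p} → toℕ k < toℕ p → toℕ k < toℕ (g p)
      g-above {p} k<p = ≰⇒> λ gp≤k → <⇒≱ k<p (subst (λ z → toℕ z ≤ toℕ k)
        (⟨$⟩ʳ-injective u (trans (agree gp≤k) (Perm.inverseʳ v))) gp≤k)

    -- The map v⁻¹u fixes the first block pointwise, hence preserves the second. There a reversed
    -- pair would contradict that `u` and `v` both increase on it.
    transition-increasing : ∀ {p q} → p Fin.< q → (v ⟨$⟩ˡ (u ⟨$⟩ʳ p)) Fin.< (v ⟨$⟩ˡ (u ⟨$⟩ʳ q))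
    transition-increasing {p} {q} p<q with toℕ p ≤? toℕ k | toℕ q ≤? toℕ k
    ... | yes p≤k | yes q≤k = subst₂ Fin._<_ (g-below p≤k) (g-below q≤k) p<q
    ... | yes p≤k | no q≰k  = subst (Fin._< g q) (g-below p≤k) (≤-<-trans p≤k (g-above (≰⇒> q≰k)))
    ... | no p≰k  | yes q≤k = contradiction (≤-trans (<⇒≤ p<q) q≤k) p≰k
    ... | no p≰k  | no q≰k with <-cmp (g p) (g q)
    ...   | tri< gp<gq _ _ = gp<gq
    ...   | tri≈ _ gp≡gq _ = contradiction p<q (<-irrefl (cong toℕ
              (⟨$⟩ʳ-injective u (⟨$⟩ʳ-injective (Perm.flip v) gp≡gq))))
    ...   | tri> _ _ gq<gp = contradiction
              (Sorted.above sorted-u p<q (≰⇒> p≰k))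
              (<-asym (subst₂ Fin._<_ (Perm.inverseʳ v) (Perm.inverseʳ v)
                (Sorted.above sorted-v gq<gp (g-above (≰⇒> q≰k)))))

  -- The row ends give the values on the first block. Then v⁻¹u and its inverse are increasing, so
  -- both are the identity.
  Filled-injective : ∀ {u v} → Sorted k u → Sorted k v → Filled k u ≐ Filled k v → u Perm.≈ v
  Filled-injective {u} {v} sorted-u sorted-v (u⊆v , v⊆u) p =
    trans (sym (Perm.inverseʳ v)) (cong (v ⟨$⟩ʳ_) (sym p≡gp))
    where
    agree : ∀ {p} → toℕ p ≤ toℕ k → u ⟨$⟩ʳ p ≡ v ⟨$⟩ʳ p
    agree p≤k = toℕ-injective
      (≤-antisym (Filled-⊆⇒≤ {u} sorted-v u⊆v p≤k) (Filled-⊆⇒≤ {v} sorted-u v⊆u p≤k))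

    g h : Fin (suc r) → Fin (suc r)
    g p = v ⟨$⟩ˡ (u ⟨$⟩ʳ p)
    h p = u ⟨$⟩ˡ (v ⟨$⟩ʳ p)

    h∘g : ∀ p → h (g p) ≡ p
    h∘g p = trans (cong (u ⟨$⟩ˡ_) (Perm.inverseʳ v)) (Perm.inverseˡ u)

    p≡gp : p ≡ g p
    p≡gp = toℕ-injective (≤-antisym
      (increasing⇒≥ g (transition-increasing sorted-u sorted-v agree) p)
      (≤-trans (increasing⇒≥ h (transition-increasing sorted-v sorted-u (sym ∘ agree)) (g p))
               (≤-reflexive (cong toℕ (h∘g p)))))


-- Standard orders and standard Young tableaux

-- Membership in `Diagram μ` is an inequality of naturals and has at most one proof, so an entry
-- depends on the cell alone.
entry-cong : ∀ {μ m} (T : SYT μ m) {p q} (p∈ : p ∈ Diagram μ) (q∈ : q ∈ Diagram μ) → p ≡ q →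
  SYT.entry T (p , p∈) ≡ SYT.entry T (q , q∈)
entry-cong T p∈ q∈ refl = cong (λ z → SYT.entry T (_ , z)) (≤-irrelevant p∈ q∈)

module _ (μ : List ℕ) {m} {ps : Vec Cell m} (standard : Standard ∅ ps)
         (range : Diagram μ ≐ Range ps) where

  open Standard standard

  private
    index : ∃ (Diagram μ) → Fin m
    index (p , p∈) = proj₁ (proj₁ range p∈)

    lookup-index : ∀ p → Vec.lookup ps (index p) ≡ proj₁ p
    lookup-index (p , p∈) = proj₂ (proj₁ range p∈)

    lookup∈ : ∀ j → Vec.lookup ps j ∈ Diagram μ
    lookup∈ j = proj₂ range (j , refl)

    index-injective : ∀ p q → index p ≡ index q → p ≡ q
    index-injective p@(_ , a) q@(_ , b) eq
      with trans (sym (lookup-index p)) (trans (cong (Vec.lookup ps) eq) (lookup-index q))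
    ... | refl = cong (_ ,_) (≤-irrelevant a b)

    -- `closed` finds the first cell no later than the second, `distinct` identifies the place found
    -- with its index, and strictness holds because the cells differ.
    index-< : ∀ {x y x′ y′} (p : (x , y) ∈ Diagram μ) (q : (x′ , y′) ∈ Diagram μ) →
      x ≤ x′ → y ≤ y′ → (x , y) ≢ (x′ , y′) → index (_ , p) Fin.< index (_ , q)
    index-< p q x≤ y≤ ≢
      with closed (index (_ , q))
             (≤-trans x≤ (≤-reflexive (cong proj₁ (sym (lookup-index (_ , q))))))
             (≤-trans y≤ (≤-reflexive (cong proj₂ (sym (lookup-index (_ , q))))))
    ... | inj₂ (j , j≤ , eq) with distinct j (index (_ , p)) (trans eq (sym (lookup-index (_ , p))))
    ...   | refl = Fin.≤∧≢⇒< j≤ λ same → ≢ (cong proj₁ (index-injective (_ , p) (_ , q) same))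

  tableau : SYT μ m
  tableau = record
    { entry        = index
    ; bijective    = (λ {p} {q} → index-injective p q) , λ j → (_ , lookup∈ j) ,
        λ { refl → distinct _ j (lookup-index (_ , lookup∈ j)) }
    ; rowsIncrease = λ p q y<y′ → index-< p q ≤-refl (<⇒≤ y<y′) λ eq → <-irrefl (cong proj₂ eq) y<y′
    ; colsIncrease = λ p q x<x′ → index-< p q (<⇒≤ x<x′) ≤-refl λ eq → <-irrefl (cong proj₁ eq) x<x′
    }

  tableau-lookup : ∀ j → Σ[ p∈ ∈ Vec.lookup ps j ∈ Diagram μ ] SYT.entry tableau (Vec.lookup ps j , p∈) ≡ j
  tableau-lookup j = lookup∈ j , distinct _ j (lookup-index (_ , lookup∈ j))

module _ {μ : List ℕ} {m} (young : IsYoungDiagram (Diagram μ)) (T : SYT μ m) where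

  open SYT T

  private
    located : (j : Fin m) → ∃ (Diagram μ)
    located j = proj₁ (proj₂ bijective j)

    entry-located : ∀ j → entry (located j) ≡ j
    entry-located j = proj₂ (proj₂ bijective j) refl

    located-entry : ∀ p → located (entry p) ≡ p
    located-entry p = proj₁ bijective (entry-located (entry p))

    row-≤ : ∀ {x y y′} (p : (x , y) ∈ Diagram μ) (q : (x , y′) ∈ Diagram μ) → y ≤ y′ →
      entry (_ , p) Fin.≤ entry (_ , q)
    row-≤ p q y≤y′ with m≤n⇒m<n∨m≡n y≤y′
    ... | inj₁ y<y′ = <⇒≤ (rowsIncrease p q y<y′)
    ... | inj₂ refl = ≤-reflexive (cong toℕ (entry-cong T p q refl))

    col-≤ : ∀ {x x′ y} (p : (x , y) ∈ Diagram μ) (q : (x′ , y) ∈ Diagram μ) → x ≤ x′ →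
      entry (_ , p) Fin.≤ entry (_ , q)
    col-≤ p q x≤x′ with m≤n⇒m<n∨m≡n x≤x′
    ... | inj₁ x<x′ = <⇒≤ (colsIncrease p q x<x′)
    ... | inj₂ refl = ≤-reflexive (cong toℕ (entry-cong T p q refl))

  reading : Vec Cell m
  reading = Vec.tabulate (proj₁ ∘ located)

  private
    lookup-reading : ∀ j → Vec.lookup reading j ≡ proj₁ (located j)
    lookup-reading = lookup∘tabulate (proj₁ ∘ located)

  lookup-reading-entry : ∀ p → Vec.lookup reading (entry p) ≡ proj₁ p
  lookup-reading-entry p = trans (lookup-reading (entry p)) (cong proj₁ (located-entry p))

  reading-range : Diagram μ ≐ Range reading
  reading-range =
      (λ p∈ → entry (_ , p∈) , lookup-reading-entry (_ , p∈))
    , λ { (j , refl) → subst (_∈ Diagram μ) (sym (lookup-reading j)) (proj₂ (located j)) }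

  reading-standard : Standard ∅ reading
  reading-standard = record
    { fresh    = λ _ ()
    ; distinct = λ j j′ eq → trans (sym (entry-located j)) (trans
        (entry-cong T (proj₂ (located j)) (proj₂ (located j′))
          (trans (sym (lookup-reading j)) (trans eq (lookup-reading j′))))
        (entry-located j′))
    ; closed   = λ j x≤ y≤ → inj₂ (earlier j
        (≤-trans x≤ (≤-reflexive (cong proj₁ (lookup-reading j))))
        (≤-trans y≤ (≤-reflexive (cong proj₂ (lookup-reading j)))))
    }
    where
    earlier : ∀ j {x y} → x ≤ proj₁ (proj₁ (located j)) → y ≤ proj₂ (proj₁ (located j)) →
      Σ[ j′ ∈ Fin m ] toℕ j′ ≤ toℕ j × Vec.lookup reading j′ ≡ (x , y)
    -- The comparison goes along row `x` to the corner cell in the column of `located j`, and then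
    -- down that column.
    earlier j x≤ y≤ = entry (_ , p∈)
      , ≤-trans (row-≤ p∈ q∈ y≤) (≤-trans (col-≤ q∈ (proj₂ (located j)) x≤)
          (≤-reflexive (cong toℕ (entry-located j))))
      , lookup-reading-entry (_ , p∈)
      where
      p∈ : _ ∈ Diagram μ
      p∈ = youngDiagram-lower young x≤ y≤ (proj₂ (located j))
      q∈ : _ ∈ Diagram μ
      q∈ = youngDiagram-lower young x≤ ≤-refl (proj₂ (located j))

Standard-resp-≐ : ∀ {l D E} {ps : Vec Cell l} → D ≐ E → Standard D ps → Standard E ps
Standard-resp-≐ (D⊆E , E⊆D) standard = record
  { fresh    = λ j → fresh j ∘ E⊆D
  ; distinct = distinct
  ; closed   = λ j x≤ y≤ → Sum.map₁ D⊆E (closed j x≤ y≤)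
  }
  where open Standard standard

-- The bijection between firing sequences and tableaux

module _ {r} {k : Fin r} {w : Permutation′ (suc r)} (sorted : Sorted k w) {m : ℕ} where

  module _ (f : FiringSequence k w m) where

    open FiringSequence f

    seq-fireable : AllFireable k Perm.id seq
    seq-fireable = valid⇒fireable {u = Perm.id} (Balanced-start k) seq valid

    order : Vec Cell m
    order = cells k Perm.id seq

    order-standard : Standard ∅ order
    order-standard = Standard-resp-≐ (Filled-id k) (cells-standard (Sorted-id k) seq seq-fireable)

    order-range : Diagram (shape k w) ≐ Range order
    order-range = to , from
      where
      filled : Filled k (product seq · Perm.id) ≐ Filled k Perm.id ∪ Range order
      filled = Filled-product (Sorted-id k) seq seq-fireable

      to : Diagram (shape k w) ⊆ Range order
      to p∈ with proj₁ filled (Filled-resp-≈ k w (product seq) (sym ∘ produces) (proj₂ (Filled≐shape sorted) p∈))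
      ... | inj₁ p∈id = contradiction (proj₁ (Filled-id k) p∈id) λ ()
      ... | inj₂ p∈ps = p∈ps

      from : Range order ⊆ Diagram (shape k w)
      from p∈ps = proj₁ (Filled≐shape sorted) (Filled-resp-≈ k (product seq) w produces (proj₂ filled (inj₂ p∈ps)))

    toTableau : SYT (shape k w) m
    toTableau = tableau (shape k w) order-standard order-range

    lookup-order : ∀ p → Vec.lookup order (SYT.entry toTableau p) ≡ proj₁ p
    lookup-order (p , p∈) = proj₂ (proj₁ order-range p∈)

    assigns : Assigns k seq toTableau
    assigns = order , places (Sorted-id k) (≐-sym (Filled-id k)) seq seq-fireable
      , tableau-lookup (shape k w) order-standard order-range

  -- The order of the cells depends on `seq` alone, not on the proofs stored in `f` and `g`, and
  -- each cell occurs in it only once.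
  toTableau-cong : ∀ f g → FiringSequence.seq f ≡ FiringSequence.seq g →
    ∀ p → SYT.entry (toTableau f) p ≡ SYT.entry (toTableau g) p
  toTableau-cong f g eq p = Standard.distinct (order-standard f) _ _
    (trans (lookup-order f p) (trans (sym (lookup-order g p))
      (cong (λ is → Vec.lookup (cells k Perm.id is) (SYT.entry (toTableau g) p)) (sym eq))))

  toTableau-injective : ∀ f g → (∀ p → SYT.entry (toTableau f) p ≡ SYT.entry (toTableau g) p) →
    FiringSequence.seq f ≡ FiringSequence.seq g
  toTableau-injective f g eq = cells-injective (Sorted-id k) _ _ (seq-fireable f) (seq-fireable g) λ j →
    let p∈ , entry≡j = tableau-lookup (shape k w) (order-standard f) (order-range f) j
    in trans (sym (lookup-order g (_ , p∈)))
         (cong (Vec.lookup (order g)) (trans (sym (eq (_ , p∈))) entry≡j))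

  module _ (T : SYT (shape k w) m) where

    private
      young : IsYoungDiagram (Diagram (shape k w))
      young = shape k w , shape-isPartition sorted , (λ p∈ → p∈) , (λ p∈ → p∈)

      ps : Vec Cell m
      ps = reading young T

      contents : Σ[ is ∈ Vec (Fin r) m ] AllFireable k Perm.id is × cells k Perm.id is ≡ ps
      contents = standard⇒cells (Sorted-id k) ps
        (Standard-resp-≐ (≐-sym (Filled-id k)) (reading-standard young T))
        λ j → Filled⊆OnBoard k w (proj₂ (Filled≐shape sorted) (proj₂ (reading-range young T) (j , refl)))

      is : Vec (Fin r) m
      is = proj₁ contents

      fireable : AllFireable k Perm.id is
      fireable = proj₁ (proj₂ contents)

      cells≡ps : cells k Perm.id is ≡ ps
      cells≡ps = proj₂ (proj₂ contents)

      filled : Filled k (product is · Perm.id) ≐ Filled k Perm.id ∪ Range ps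
      filled = subst (λ qs → Filled k (product is · Perm.id) ≐ Filled k Perm.id ∪ Range qs) cells≡ps
        (Filled-product (Sorted-id k) is fireable)

      product≐w : Filled k (product is · Perm.id) ≐ Filled k w
      product≐w = to , from
        where
        to : Filled k (product is · Perm.id) ⊆ Filled k w
        to p∈ with proj₁ filled p∈
        ... | inj₁ p∈id = contradiction (proj₁ (Filled-id k) p∈id) λ ()
        ... | inj₂ p∈ps = proj₂ (Filled≐shape sorted) (proj₂ (reading-range young T) p∈ps)
        from : Filled k w ⊆ Filled k (product is · Perm.id)
        from p∈ = proj₂ filled (inj₂ (proj₁ (reading-range young T) (proj₁ (Filled≐shape sorted) p∈)))

    -- The vertices are given by the contents of the cells of `T`, taken in the order of their
    -- entries. Their product has the same diagram as `w` and is therefore `w`.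
    fromTableau : FiringSequence k w m
    fromTableau = record
      { seq      = is
      ; valid    = fireable⇒valid {u = Perm.id} (Balanced-start k) is fireable
      ; produces = Filled-injective (product-sorted (Sorted-id k) is fireable) sorted product≐w
      }

    toTableau-fromTableau : ∀ p → SYT.entry (toTableau fromTableau) p ≡ SYT.entry T p
    toTableau-fromTableau p = Standard.distinct (order-standard fromTableau) _ _ (trans
      (lookup-order fromTableau p)
      (trans (sym (lookup-reading-entry young T p))
        (cong (λ qs → Vec.lookup qs (SYT.entry T p)) (sym cells≡ps))))

theorem3p15 : (r : ℕ) (k : Fin r) (w : Permutation′ (suc r)) → Grassmannian k w →
    (m : ℕ) → IsLength w m →
    Σ[ φ ∈ Bijection (FiringSequence-setoid k w m) (SYT-setoid (shape k w) m) ]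
    ((f : FiringSequence k w m) → Assigns k (FiringSequence.seq f) (Bijection.to φ f))
theorem3p15 r k w grass m len = bijection , assigns sorted
  where
  sorted : Sorted k w
  sorted = grassmannian⇒sorted grass len

  bijection : Bijection (FiringSequence-setoid k w m) (SYT-setoid (shape k w) m)
  bijection = record
    { to        = toTableau sorted
    ; cong      = λ {f} {g} → toTableau-cong sorted f g
    ; bijective = (λ {f} {g} → toTableau-injective sorted f g)
                -- Surjectivity is demanded for every `f` with the same sequence as the preimage,
                -- hence the passage through `toTableau-cong`.
                , λ T → fromTableau sorted T , λ {f} eq p →
                    trans (toTableau-cong sorted f (fromTableau sorted T) eq p)
                          (toTableau-fromTableau sorted T p)
    }
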